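{- The Tuza constants satisfy $c_7 \le 0.1916$, $c_8 \le 0.1772$, and $c_k \le 0.1667$ for every integer $k$ with $9 \le k \le 17$.
   Context: A hypergraph $H=(V,E)$ consists of a finite vertex set $V$ and a finite collection $E$ of subsets of $V$ (edges). $H$ is $k$-uniform if every edge has exactly $k$ vertices. A transversal of $H$ is a set $T\subseteq V$ meeting every edge; $\tau(H)$ denotes the minimum size of a transversal. For $k\ge 1$, the Tuza constant is $c_k=\sup_{H} \tau(H)/(m+n)$, where the supremum ranges over all $k$-uniform hypergraphs $H$, with $n=|V|$ and $m=|E|$. -}

module Defs where

open import Level using (Level; 0ℓ; _⊔_) renaming (suc to lsuc)
open import Data.Nat.Base as ℕ using (ℕ; suc; NonZero)
import Data.Nat.Properties as ℕ
open import Data.Nat.Induction using (<-wellFounded)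
open import Data.Integer.Base using (+_)
open import Data.Rational.Base as ℚ using (ℚ; _/_)
import Data.Rational.Properties as ℚ
open import Data.Fin.Base using (zero; suc)
open import Data.Fin.Subset using (Subset; ∣_∣; _∩_; ⊤; Nonempty; inside; outside)
open import Data.Fin.Subset.Properties using (nonempty?; anySubset?; ∩-identityˡ)
open import Data.Vec.Base using ([]; _∷_; here; there)
open import Data.List.Base using (List; length)
open import Data.List.Relation.Unary.All as All using (All)
open import Data.List.Relation.Unary.Unique.Propositional using (Unique)
open import Data.Product.Base using (∃; _×_; _,_; proj₁)
open import Induction.WellFounded using (Acc; acc)
open import Relation.Nullary.Decidable using (yes; no; _×-dec_)
open import Relation.Unary using (Pred; Decidable; _⊆_)
open import Relation.Binary.PropositionalEquality using (_≡_; refl; sym; subst)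

private
  variable
    i ℓ ℓ′ : Level
    n : ℕ

-- The standard library has no real numbers.  A real is given here by its
-- lower Dedekind cut {p ∈ ℚ ∣ p < x}.  Neither bound is required of the cut,
-- so the values -∞ and +∞ are included and every family of rationals has a
-- supremum.
record LowerReal (ℓ : Level) : Set (lsuc ℓ) where
  field
    below   : Pred ℚ ℓ
    closed  : ∀ {p q} → p ℚ.< q → below q → below p
    rounded : ∀ {p} → below p → ∃ λ q → p ℚ.< q × below q

open LowerReal public

infix 4 _≤ᴿ_

_≤ᴿ_ : LowerReal ℓ → LowerReal ℓ′ → Set (ℓ ⊔ ℓ′)
x ≤ᴿ y = below x ⊆ below y

fromℚ : ℚ → LowerReal 0ℓ
fromℚ q .below p             = p ℚ.< q
fromℚ q .closed p<r r<q      = ℚ.<-trans p<r r<q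
fromℚ q .rounded p<q with ℚ.<-dense p<q
... | r , p<r , r<q          = r , p<r , r<q

-- The cut of a supremum is the union of the cuts.
sup : {I : Set i} → (I → ℚ) → LowerReal i
sup f .below p               = ∃ λ j → p ℚ.< f j
sup f .closed p<q (j , q<fj) = j , ℚ.<-trans p<q q<fj
sup f .rounded (j , p<fj) with ℚ.<-dense p<fj
... | q , p<q , q<fj         = q , p<q , j , q<fj

sup-upper : {I : Set i} (f : I → ℚ) → ∀ j → fromℚ (f j) ≤ᴿ sup f
sup-upper f j p<fj = j , p<fj

sup-least : {I : Set i} (f : I → ℚ) (x : LowerReal ℓ) →
            (∀ j → fromℚ (f j) ≤ᴿ x) → sup f ≤ᴿ x
sup-least f x f≤x (j , p<fj) = f≤x j p<fj

-- The vertex set is Fin order.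
record Hypergraph : Set where
  field
    order    : ℕ
    edges    : List (Subset order)
    distinct : Unique edges

  size : ℕ
  size = length edges

open Hypergraph public

IsUniform : ℕ → Hypergraph → Set
IsUniform k H = All (λ e → ∣ e ∣ ≡ k) (edges H)

IsTransversal : (H : Hypergraph) → Subset (order H) → Set
IsTransversal H T = All (λ e → Nonempty (T ∩ e)) (edges H)

isTransversal? : (H : Hypergraph) → Decidable (IsTransversal H)
isTransversal? H T = All.all? (λ e → nonempty? (T ∩ e)) (edges H)

IsMinimum : Pred (Subset n) ℓ → Subset n → Set ℓ
IsMinimum P S = P S × (∀ S′ → P S′ → ∣ S ∣ ℕ.≤ ∣ S′ ∣)

minimum : {P : Pred (Subset n) ℓ} → Decidable P → ∃ P → ∃ (IsMinimum P)
minimum {n = n} {P = P} P? (S₀ , pS₀) = go S₀ pS₀ (<-wellFounded ∣ S₀ ∣)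
  where
  go : ∀ S → P S → Acc ℕ._<_ ∣ S ∣ → ∃ (IsMinimum P)
  go S pS (acc rec) with anySubset? (λ S′ → P? S′ ×-dec (∣ S′ ∣ ℕ.<? ∣ S ∣))
  ... | yes (S′ , pS′ , S′<S) = go S′ pS′ (rec S′<S)
  ... | no  ∄smaller          =
    S , pS , λ S′ pS′ → ℕ.≮⇒≥ λ S′<S → ∄smaller (S′ , pS′ , S′<S)

-- A hypergraph with an empty edge has no transversal, so τ takes the existence
-- of one as an argument.
τ : (H : Hypergraph) → ∃ (IsTransversal H) → ℕ
τ H t = ∣ proj₁ (minimum (isTransversal? H) t) ∣

τ-spec : (H : Hypergraph) (t : ∃ (IsTransversal H)) →
         ∃ λ T → IsMinimum (IsTransversal H) T × ∣ T ∣ ≡ τ H t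
τ-spec H t = let (T , min) = minimum (isTransversal? H) t in T , min , refl

∣S∣≢0⇒Nonempty : .{{NonZero n}} → ∀ {m} (S : Subset m) → ∣ S ∣ ≡ n → Nonempty S
∣S∣≢0⇒Nonempty {n = suc _} (inside  ∷ S) _  = zero , here
∣S∣≢0⇒Nonempty {n = suc _} (outside ∷ S) eq =
  let (x , x∈S) = ∣S∣≢0⇒Nonempty S eq in suc x , there x∈S

uniform⇒transversal : ∀ k .{{_ : NonZero k}} (H : Hypergraph) →
                      IsUniform k H → ∃ (IsTransversal H)
uniform⇒transversal k H u =
  ⊤ , All.map (λ {e} ∣e∣≡k →
        subst Nonempty (sym (∩-identityˡ e)) (∣S∣≢0⇒Nonempty e ∣e∣≡k)) u

-- The hypergraph with neither vertices nor edges is left out, since there the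
-- ratio τ(H)/(m+n) would be 0/0.
record UniformHypergraph (k : ℕ) : Set where
  field
    hypergraph : Hypergraph
    uniform    : IsUniform k hypergraph
    .{{m+n≢0}} : NonZero (size hypergraph ℕ.+ order hypergraph)

tuzaRatio : ∀ k .{{_ : NonZero k}} → UniformHypergraph k → ℚ
tuzaRatio k H = + τ hypergraph (uniform⇒transversal k hypergraph uniform)
                / (size hypergraph ℕ.+ order hypergraph)
  where open UniformHypergraph H

c : ∀ k .{{_ : NonZero k}} → LowerReal 0ℓ
c k = sup (tuzaRatio k)

{-# OPTIONS --safe #-}

-- Build a transversal greedily, each time taking a vertex of maximum degree and
-- deleting the edges through it.  Progress is measured by the potential
-- Φ = Σ_v a(deg v) + B m, where a is a concave function with a(0) = 0.  If the
-- vertex taken has degree d, at least kd vertex-edge incidences disappear, and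
-- by concavity and maximality of d each of them at a vertex other than the
-- chosen one costs at least a(d) − a(d−1).  So Φ drops by at least
--   a(d) + B d + (k−1) d (a(d) − a(d−1)).
-- If this is ≥ N for every d ≥ 1 and a ≤ B, then N τ ≤ Φ ≤ B (n + m).

module Submission where

open import Defs
open import Data.Nat.Base using (ℕ; NonZero; _≤_)
open import Data.Integer.Base using (+_)
open import Data.Rational.Base using (_/_)
open import Data.Product.Base using (_×_)

open import Data.Bool.Base using (if_then_else_)
open import Data.Fin.Base as Fin using (Fin; toℕ; fromℕ<)
open import Data.Fin.Properties using (all?; toℕ-fromℕ<)
open import Data.Fin.Subset using (Subset; ∣_∣; _∩_; _∪_; ⁅_⁆; ⊥; Nonempty; inside; outside)
open import Data.Fin.Subset.Properties
  using (_∈?_; x∈p∩q⁺; x∈p∩q⁻; p⊆p∪q; q⊆p∪q; x∈⁅x⁆; ∣⁅x⁆∣≡1; ∣⊥∣≡0)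
import Data.Integer.Base as ℤ
import Data.Integer.Properties as ℤ
open import Data.List.Base using (List; []; _∷_; length; filter; take; allFin)
open import Data.List.Extrema.Nat using (argmax; f[xs]≤f[argmax])
open import Data.List.Membership.Propositional.Properties using (∈-allFin)
open import Data.List.Properties using (filter-idem; filter-some)
open import Data.List.Relation.Unary.All as All using (All; []; _∷_)
import Data.List.Relation.Unary.All.Properties as All
open import Data.List.Relation.Unary.AllPairs using (AllPairs; []; _∷_; allPairs?)
open import Data.List.Relation.Unary.Any using (here)
open import Data.Nat.Base using (zero; suc; _+_; _*_; _<_; _≥_; z≤n; s≤s; s≤s⁻¹; >-nonZero; >-nonZero⁻¹)
open import Data.Nat.Induction using (<-wellFounded)
open import Data.Nat.ListAction using (sum)
open import Data.Nat.Properties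
open import Data.Nat.Tactic.RingSolver using (solve-∀)
open import Data.Product.Base using (∃; _,_)
open import Data.Rational.Base as ℚ using (toℚᵘ)
import Data.Rational.Properties as ℚ
import Data.Rational.Unnormalised.Base as ℚᵘ
import Data.Rational.Unnormalised.Properties as ℚᵘ
open import Data.Vec.Base using ([]; _∷_)
open import Function.Base using (_∘_)
open import Induction.WellFounded using (Acc; acc)
open import Relation.Binary.PropositionalEquality using (_≡_; refl; sym; trans; cong; cong₂; subst; subst₂)
open import Relation.Nullary.Decidable using (Dec; yes; no; does; from-yes; map′; _×-dec_)
open import Relation.Nullary.Negation using (contradiction)
open import Relation.Unary using (Pred; Decidable)
open import Relation.Unary.Properties using (∁?)

open import Algebra.Properties.Semiring.Sum +-*-semiring
  using (sum-syntax; sum-remove; ∑-distrib-+; *-distribˡ-sum)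

private
  variable
    n k N B : ℕ
    ds : List ℕ

-- Sums over the vertices

∑-mono : {f g : Fin n → ℕ} → (∀ i → f i ≤ g i) → ∑[ i < n ] f i ≤ ∑[ i < n ] g i
∑-mono {zero}  f≤g = z≤n
∑-mono {suc n} f≤g = +-mono-≤ (f≤g Fin.zero) (∑-mono (f≤g ∘ Fin.suc))

-- f v - g v ≤ ∑ f - ∑ g, without subtraction.
∑-mono-gap : (f g : Fin n → ℕ) → (∀ i → f i ≤ g i) → ∀ v →
             g v + ∑[ i < n ] f i ≤ f v + ∑[ i < n ] g i
∑-mono-gap {suc n} f g f≤g v = begin
  g v + ∑[ i < suc n ] f i
    ≡⟨ cong (_+_ (g v)) (sum-remove {i = v} f) ⟩
  g v + (f v + ∑[ i < n ] f (Fin.punchIn v i))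
    ≤⟨ +-monoʳ-≤ (g v) (+-monoʳ-≤ (f v) (∑-mono (f≤g ∘ Fin.punchIn v))) ⟩
  g v + (f v + ∑[ i < n ] g (Fin.punchIn v i))
    ≡⟨ swap (g v) (f v) _ ⟩
  f v + (g v + ∑[ i < n ] g (Fin.punchIn v i))
    ≡⟨ cong (_+_ (f v)) (sum-remove {i = v} g) ⟨
  f v + ∑[ i < suc n ] g i
    ∎
  where
  open ≤-Reasoning
  swap : ∀ x y z → x + (y + z) ≡ y + (x + z)
  swap = solve-∀

-- Counting in split lists and in subsets

module _ {a p q} {A : Set a} {P : Pred A p} {Q : Pred A q} (P? : Decidable P) (Q? : Decidable Q) where

  length-filter-filter-∁ : ∀ xs → length (filter Q? xs) ≡
    length (filter Q? (filter P? xs)) + length (filter Q? (filter (∁? P?) xs))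
  length-filter-filter-∁ []       = refl
  length-filter-filter-∁ (x ∷ xs) with ih ← length-filter-filter-∁ xs | P? x
  ... | yes _ with Q? x
  ...   | yes _ = cong suc ih
  ...   | no  _ = ih
  length-filter-filter-∁ (x ∷ xs) | no _ with Q? x
  ...   | yes _ = trans (cong suc ih) (sym (+-suc _ _))
  ...   | no  _ = ih

length-filter-∁ : ∀ {a p} {A : Set a} {P : Pred A p} (P? : Decidable P) → ∀ xs →
                  length xs ≡ length (filter P? xs) + length (filter (∁? P?) xs)
length-filter-∁ P? []       = refl
length-filter-∁ P? (x ∷ xs) with ih ← length-filter-∁ P? xs | P? x
... | yes _ = cong suc ih
... | no  _ = trans (cong suc ih) (sym (+-suc _ _))

∣p∪q∣≤∣p∣+∣q∣ : (p q : Subset n) → ∣ p ∪ q ∣ ≤ ∣ p ∣ + ∣ q ∣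
∣p∪q∣≤∣p∣+∣q∣ []            []            = z≤n
∣p∪q∣≤∣p∣+∣q∣ (outside ∷ p) (outside ∷ q) = ∣p∪q∣≤∣p∣+∣q∣ p q
∣p∪q∣≤∣p∣+∣q∣ (inside  ∷ p) (outside ∷ q) = s≤s (∣p∪q∣≤∣p∣+∣q∣ p q)
∣p∪q∣≤∣p∣+∣q∣ (outside ∷ p) (inside  ∷ q) =
  ≤-trans (s≤s (∣p∪q∣≤∣p∣+∣q∣ p q)) (≤-reflexive (sym (+-suc ∣ p ∣ ∣ q ∣)))
∣p∪q∣≤∣p∣+∣q∣ (inside  ∷ p) (inside  ∷ q) =
  s≤s (≤-trans (∣p∪q∣≤∣p∣+∣q∣ p q) (+-monoʳ-≤ ∣ p ∣ (n≤1+n ∣ q ∣)))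

∑-indicator : (p : Subset n) → ∑[ v < n ] (if does (v ∈? p) then 1 else 0) ≡ ∣ p ∣
∑-indicator []            = refl
∑-indicator (inside  ∷ p) = cong suc (∑-indicator p)
∑-indicator (outside ∷ p) = ∑-indicator p

-- Vertex degrees and double counting

deg : List (Subset n) → Fin n → ℕ
deg es v = length (filter (v ∈?_) es)

deg-∷ : (e : Subset n) (es : List (Subset n)) → ∀ v →
        deg (e ∷ es) v ≡ (if does (v ∈? e) then 1 else 0) + deg es v
deg-∷ e es v with v ∈? e
... | yes _ = refl
... | no  _ = refl

-- Adding an edge `e` raises the degree of exactly its own vertices, so the degree sum grows by
-- `∣ e ∣`. Asking for `k ≤ ∣ e ∣` rather than equality lets weights chosen for one uniformity serve
-- all larger ones.
handshake : (es : List (Subset n)) → All (λ e → k ≤ ∣ e ∣) es →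
            length es * k ≤ ∑[ v < n ] deg es v
handshake []       []         = z≤n
handshake {n} {k} (e ∷ es) (k≤e ∷ k≤es) = begin
  k + length es * k            ≤⟨ +-mono-≤ k≤e (handshake es k≤es) ⟩
  ∣ e ∣ + ∑[ v < n ] deg es v   ≡⟨ cong (_+ ∑[ v < n ] deg es v) (∑-indicator e) ⟨
  ∑[ v < n ] (if does (v ∈? e) then 1 else 0) + ∑[ v < n ] deg es v
    ≡⟨ ∑-distrib-+ (λ v → if does (v ∈? e) then 1 else 0) (deg es) ⟨
  ∑[ v < n ] ((if does (v ∈? e) then 1 else 0) + deg es v)
    ≤⟨ ∑-mono (λ v → ≤-reflexive (sym (deg-∷ e es v))) ⟩
  ∑[ v < n ] deg (e ∷ es) v     ∎
  where open ≤-Reasoning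

-- Concave weight functions

-- The function a is encoded by the list of its increments, extended by zeros.
entry : List ℕ → ℕ → ℕ
entry []       _       = 0
entry (x ∷ xs) zero    = x
entry (x ∷ xs) (suc i) = entry xs i

weight : List ℕ → ℕ → ℕ
weight ds d = sum (take d ds)

entry-≤ : ∀ {x} (xs : List ℕ) → All (x ≥_) xs → ∀ i → entry xs i ≤ x
entry-≤ []       []         i       = z≤n
entry-≤ (y ∷ ys) (y≤x ∷ _)  zero    = y≤x
entry-≤ (y ∷ ys) (_ ∷ ys≤x) (suc i) = entry-≤ ys ys≤x i

entry-antitone : AllPairs _≥_ ds → ∀ {i j} → i ≤ j → entry ds j ≤ entry ds i
entry-antitone []                 _                       = z≤n
entry-antitone (_ ∷ _)            {zero}  {zero}  _       = ≤-refl
entry-antitone (_∷_ {xs = xs} p _) {zero}  {suc j} _       = entry-≤ xs p j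
entry-antitone (_ ∷ ps)           {suc i} {suc j} (s≤s l) = entry-antitone ps l

entry-≥length : ∀ ds {i} → length ds ≤ i → entry ds i ≡ 0
entry-≥length []       _       = refl
entry-≥length (x ∷ ds) (s≤s l) = entry-≥length ds l

weight-suc : ∀ ds i → weight ds (suc i) ≡ weight ds i + entry ds i
weight-suc []       zero    = refl
weight-suc []       (suc i) = refl
weight-suc (x ∷ ds) zero    = +-comm x 0
weight-suc (x ∷ ds) (suc i) = trans (cong (_+_ x) (weight-suc ds i)) (sym (+-assoc x _ _))

weight-≤sum : ∀ ds i → weight ds i ≤ sum ds
weight-≤sum []       zero    = z≤n
weight-≤sum []       (suc i) = z≤n
weight-≤sum (x ∷ ds) zero    = z≤n
weight-≤sum (x ∷ ds) (suc i) = +-monoʳ-≤ x (weight-≤sum ds i)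

weight-≥length : ∀ ds {i} → length ds ≤ i → weight ds i ≡ sum ds
weight-≥length []       {zero}  _ = refl
weight-≥length []       {suc i} _ = refl
weight-≥length (x ∷ ds) (s≤s l)   = cong (_+_ x) (weight-≥length ds l)

-- Passing from `i` to `i + r` adds the increments with indices from `i` to `i + r` - 1. These
-- indices are at most `D`, so each such increment is at least `entry ds D`.
weight-concave : AllPairs _≥_ ds → ∀ i r {D} → i + r ≤ suc D →
                 weight ds i + entry ds D * r ≤ weight ds (i + r)
weight-concave {ds} dec i zero    {D} _
  rewrite *-zeroʳ (entry ds D) | +-identityʳ i | +-identityʳ (weight ds i) = ≤-refl
weight-concave {ds} dec i (suc r) {D} l rewrite +-suc i r = begin
  weight ds i + δ * suc r
    ≡⟨ shift (weight ds i) δ r ⟩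
  (weight ds i + δ * r) + δ
    ≤⟨ +-mono-≤ (weight-concave dec i r (m≤n⇒m≤1+n (s≤s⁻¹ l))) (entry-antitone dec (s≤s⁻¹ l)) ⟩
  weight ds (i + r) + entry ds (i + r)
    ≡⟨ weight-suc ds (i + r) ⟨
  weight ds (suc (i + r))
    ∎
  where
  open ≤-Reasoning
  δ = entry ds D
  shift : ∀ x y z → x + y * suc z ≡ (x + y * z) + y
  shift = solve-∀

-- Conditions on the weights

-- Indexed by d − 1, and with the term d (a(d) − a(d−1)) moved to the left to
-- avoid subtraction.
Gain : ℕ → ℕ → ℕ → List ℕ → ℕ → Set
Gain k N B ds d =
  N + entry ds d * suc d ≤ weight ds (suc d) + B * suc d + entry ds d * (suc d * k)

-- A finite certificate for `Gain` at all degrees. `gain` covers the degrees 1 to `length ds`. At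
-- later degrees the increment is 0 and the weight stays at `sum ds`, so `Gain` only compares `N`
-- with `sum ds` plus `B` times the degree. `tail` is the first such case, and it implies the rest
-- because the right side grows.
record Admissible (k N B : ℕ) (ds : List ℕ) : Set where
  constructor admissible
  field
    decreasing : AllPairs _≥_ ds
    bounded    : sum ds ≤ B
    gain       : ∀ (i : Fin (length ds)) → Gain k N B ds (toℕ i)
    tail       : N ≤ sum ds + B * suc (length ds)

open Admissible

admissible? : ∀ k N B ds → Dec (Admissible k N B ds)
admissible? k N B ds = map′
  (λ (dec , bnd , gn , tl) → admissible dec bnd gn tl)
  (λ adm → decreasing adm , bounded adm , gain adm , tail adm)
  (allPairs? (λ x y → y ≤? x) ds
    ×-dec sum ds ≤? B
    ×-dec all? (λ i → _ ≤? _)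
    ×-dec N ≤? _)

admissible⇒gain : Admissible k N B ds → ∀ d → Gain k N B ds d
admissible⇒gain {k} {N} {B} {ds} adm d with d <? length ds
... | yes d<l = subst (Gain k N B ds) (toℕ-fromℕ< d<l) (gain adm (fromℕ< d<l))
... | no  d≮l
  rewrite entry-≥length ds (≮⇒≥ d≮l) | weight-≥length ds (m≤n⇒m≤1+n (≮⇒≥ d≮l))
        | +-identityʳ N | +-identityʳ (sum ds + B * suc d)
  = ≤-trans (tail adm) (+-monoʳ-≤ (sum ds) (*-monoʳ-≤ B (s≤s (≮⇒≥ d≮l))))

-- Deleting a vertex of maximum degree

max-degree-vertex : (es : List (Subset n)) → Fin n → ∃ λ v → ∀ u → deg es u ≤ deg es v
max-degree-vertex {n} es x =
  -- `argmax` needs a starting candidate, and `x` supplies one.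
  argmax (deg es) x (allFin n) ,
  λ u → All.lookup (f[xs]≤f[argmax] {f = deg es} x (allFin n)) (∈-allFin u)

module _ (v : Fin n) (es : List (Subset n)) where

  link deletion : List (Subset n)
  link     = filter (v ∈?_) es
  deletion = filter (∁? (v ∈?_)) es

  deg-split : ∀ u → deg es u ≡ deg deletion u + deg link u
  deg-split u = trans (length-filter-filter-∁ (v ∈?_) (u ∈?_) es) (+-comm (deg link u) _)

  deg-link : deg link v ≡ deg es v
  deg-link = cong length (filter-idem (v ∈?_) es)

  deg-deletion : deg deletion v ≡ 0
  deg-deletion = +-cancelʳ-≡ (deg link v) _ 0 (trans (sym (deg-split v)) (sym deg-link))

  length-split : length es ≡ deg es v + length deletion
  length-split = length-filter-∁ (v ∈?_) es

  extend-transversal : ∀ {T} → All (λ e → Nonempty (T ∩ e)) deletion →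
                       All (λ e → Nonempty ((T ∪ ⁅ v ⁆) ∩ e)) es
  extend-transversal {T} tr = All.filter⁻ (v ∈?_)
    (All.map (λ v∈e → v , x∈p∩q⁺ (q⊆p∪q T ⁅ v ⁆ (x∈⁅x⁆ v) , v∈e)) (All.all-filter (v ∈?_) es))
    (All.map (λ {e} (x , x∈) → let (x∈T , x∈e) = x∈p∩q⁻ T e x∈
                               in x , x∈p∩q⁺ (p⊆p∪q ⁅ v ⁆ x∈T , x∈e)) tr)

∣T∪⁅v⁆∣≤1+∣T∣ : (T : Subset n) → ∀ v → ∣ T ∪ ⁅ v ⁆ ∣ ≤ suc ∣ T ∣
∣T∪⁅v⁆∣≤1+∣T∣ T v = ≤-trans (∣p∪q∣≤∣p∣+∣q∣ T ⁅ v ⁆)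
  (≤-reflexive (trans (cong (_+_ ∣ T ∣) (∣⁅x⁆∣≡1 v)) (+-comm ∣ T ∣ 1)))

-- The potential and the greedy construction

potential : ℕ → List ℕ → List (Subset n) → ℕ
potential {n} B ds es = ∑[ u < n ] weight ds (deg es u) + B * length es

potential-drop : Admissible k N B ds → (es : List (Subset n)) → All (λ e → k ≤ ∣ e ∣) es →
                 ∀ v {D} → (∀ u → deg es u ≤ deg es v) → deg es v ≡ suc D →
                 N + potential B ds (deletion v es) ≤ potential B ds es
potential-drop {k} {N} {B} {ds} {n} adm es k≤es v {D} max deg≡ =
  -- `R` also counts the `suc D` incidences at `v` itself, although the loss there is all of `W` and
  -- not `δ * suc D`. Adding `δ * suc D` to both sides corrects for this without subtraction.
  +-cancelʳ-≤ (δ * suc D) _ _ (begin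
    N + (S′ + B * m′) + δ * suc D
      ≡⟨ shuffle₁ N S′ (B * m′) (δ * suc D) ⟩
    (N + δ * suc D) + (S′ + B * m′)
      ≤⟨ +-monoˡ-≤ (S′ + B * m′) (admissible⇒gain adm D) ⟩
    (W + B * suc D + δ * (suc D * k)) + (S′ + B * m′)
      ≤⟨ +-monoˡ-≤ (S′ + B * m′) (+-monoʳ-≤ (W + B * suc D) (*-monoʳ-≤ δ link-handshake)) ⟩
    (W + B * suc D + δ * R) + (S′ + B * m′)
      ≡⟨ shuffle₂ W B (suc D) (δ * R) S′ m′ ⟩
    (W + (S′ + δ * R)) + B * (suc D + m′)
      ≤⟨ +-monoˡ-≤ (B * (suc D + m′)) gap ⟩
    (δ * suc D + S) + B * (suc D + m′)
      ≡⟨ shuffle₃ (δ * suc D) S _ ⟩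
    (S + B * (suc D + m′)) + δ * suc D
      ≡⟨ cong (λ m → S + B * m + δ * suc D) (trans (length-split v es) (cong (_+ m′) deg≡)) ⟨
    (S + B * length es) + δ * suc D ∎)
  where
  open ≤-Reasoning
  δ = entry ds D
  W = weight ds (suc D)
  S = ∑[ u < n ] weight ds (deg es u)
  S′ = ∑[ u < n ] weight ds (deg (deletion v es) u)
  R = ∑[ u < n ] deg (link v es) u
  m′ = length (deletion v es)

  -- A lower estimate of the old weight of `u`: its new weight plus `δ` for every lost incidence. At
  -- `v` the new weight is 0, so the estimate is `δ * suc D` against the true `W`. This slack at `v`
  -- is what `gap` extracts.
  after : Fin n → ℕ
  after u = weight ds (deg (deletion v es) u) + δ * deg (link v es) u

  -- Maximality of the degree of `v` enters here: it keeps every increment lost at `u` at an index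
  -- of at most `D`, hence at least `δ`.
  after≤ : ∀ u → after u ≤ weight ds (deg es u)
  after≤ u rewrite deg-split v es u = weight-concave (decreasing adm) _ _
    (≤-trans (≤-reflexive (sym (deg-split v es u))) (≤-trans (max u) (≤-reflexive deg≡)))

  ∑-after : ∑[ u < n ] after u ≡ S′ + δ * R
  ∑-after = trans (∑-distrib-+ (weight ds ∘ deg (deletion v es)) (λ u → δ * deg (link v es) u))
                  (cong (_+_ S′) (sym (*-distribˡ-sum δ (deg (link v es)))))

  after-v : after v ≡ δ * suc D
  after-v rewrite deg-deletion v es | deg-link v es | deg≡ = refl

  gap : W + (S′ + δ * R) ≤ δ * suc D + S
  gap = begin
    W + (S′ + δ * R)                            ≡⟨ cong₂ _+_ (cong (weight ds) deg≡) ∑-after ⟨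
    weight ds (deg es v) + ∑[ u < n ] after u    ≤⟨ ∑-mono-gap after _ after≤ v ⟩
    after v + S                                 ≡⟨ cong (_+ S) after-v ⟩
    δ * suc D + S                               ∎

  link-handshake : suc D * k ≤ R
  link-handshake = subst (λ d → d * k ≤ R) deg≡
    (handshake (link v es) (All.filter⁺ (v ∈?_) k≤es))

  shuffle₁ : ∀ x y z w → x + (y + z) + w ≡ (x + w) + (y + z)
  shuffle₁ = solve-∀
  shuffle₂ : ∀ w b d r s m → (w + b * d + r) + (s + b * m) ≡ (w + (s + r)) + b * (d + m)
  shuffle₂ = solve-∀
  shuffle₃ : ∀ x y z → (x + y) + z ≡ (y + z) + x
  shuffle₃ = solve-∀

-- Induction on the number of edges. Each chosen vertex enlarges the transversal by at most one, and
-- the potential drop of at least `N` pays for it.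
greedy-transversal : .{{NonZero k}} → Admissible k N B ds →
  (es : List (Subset n)) → All (λ e → k ≤ ∣ e ∣) es →
  ∃ λ T → All (λ e → Nonempty (T ∩ e)) es × N * ∣ T ∣ ≤ potential B ds es
greedy-transversal {k} {N} {B} {ds} {n} adm es k≤es = go es k≤es (<-wellFounded (length es))
  where
  open ≤-Reasoning
  go : ∀ es → All (λ e → k ≤ ∣ e ∣) es → Acc _<_ (length es) →
       ∃ λ T → All (λ e → Nonempty (T ∩ e)) es × N * ∣ T ∣ ≤ potential B ds es
  go [] [] _ = ⊥ , [] , ≤-trans (≤-reflexive (trans (cong (N *_) (∣⊥∣≡0 n)) (*-zeroʳ N))) z≤n
  go es@(e ∷ _) k≤es@(k≤e ∷ _) (acc rec)
    with x , x∈e ← ∣S∣≢0⇒Nonempty {{>-nonZero (≤-trans (>-nonZero⁻¹ k) k≤e)}} e refl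
    with v , max ← max-degree-vertex es x
    with deg es v in deg≡
  -- The first edge contains `x`, so `x` has positive degree and the maximum degree cannot be 0.
  ... | zero  = contradiction (≤-trans (filter-some (x ∈?_) (here x∈e)) (max x)) λ ()
  ... | suc D
    with T , tr , bound ← go (deletion v es) (All.filter⁺ (∁? (v ∈?_)) k≤es)
           -- Termination: the deletion removes exactly `suc D` edges, so at least one.
           (rec (subst (length (deletion v es) <_)
                       (sym (trans (length-split v es) (cong (_+ length (deletion v es)) deg≡))) (s≤s (m≤n+m _ D))))
    = T ∪ ⁅ v ⁆ , extend-transversal v es tr , (begin
      N * ∣ T ∪ ⁅ v ⁆ ∣                      ≤⟨ *-monoʳ-≤ N (∣T∪⁅v⁆∣≤1+∣T∣ T v) ⟩
      N * suc ∣ T ∣                          ≡⟨ *-suc N ∣ T ∣ ⟩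
      N + N * ∣ T ∣                          ≤⟨ +-monoʳ-≤ N bound ⟩
      N + potential B ds (deletion v es)     ≤⟨ potential-drop adm es k≤es v
                                                 (λ u → ≤-trans (max u) (≤-reflexive (sym deg≡))) deg≡ ⟩
      potential B ds es                      ∎)

-- From the potential to the Tuza constants

∑-const-≤ : ∀ {b} {f : Fin n → ℕ} → (∀ i → f i ≤ b) → ∑[ i < n ] f i ≤ n * b
∑-const-≤ {zero}  f≤b = z≤n
∑-const-≤ {suc n} f≤b = +-mono-≤ (f≤b Fin.zero) (∑-const-≤ (f≤b ∘ Fin.suc))

/-mono-cross : ∀ t m b n .{{_ : NonZero m}} .{{_ : NonZero n}} →
               t * n ≤ b * m → + t / m ℚ.≤ + b / n
/-mono-cross t m@(suc m-1) b n@(suc n-1) tn≤bm = ℚ.toℚᵘ-cancel-≤ (begin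
  toℚᵘ (+ t / m)     ≃⟨ ℚ.toℚᵘ-fromℚᵘ (ℚᵘ.mkℚᵘ (+ t) m-1) ⟩
  ℚᵘ.mkℚᵘ (+ t) m-1  ≤⟨ ℚᵘ.*≤* (subst₂ ℤ._≤_ (ℤ.pos-* t n) (ℤ.pos-* b m) (ℤ.+≤+ tn≤bm)) ⟩
  ℚᵘ.mkℚᵘ (+ b) n-1  ≃⟨ ℚ.toℚᵘ-fromℚᵘ (ℚᵘ.mkℚᵘ (+ b) n-1) ⟨
  toℚᵘ (+ b / n)     ∎)
  where
  open ℚᵘ.≤-Reasoning

-- A minimum transversal is no larger than the greedy one, and initially every vertex weighs at most
-- `sum ds ≤ B`. The certificate is for `j ≤ k` because edges of size `k` have at least `j`
-- vertices; thus weights for 9 also treat every larger `k`.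
admissible⇒τ-bound : ∀ {k j} .{{_ : NonZero j}} .{{_ : NonZero k}} → Admissible j N B ds → j ≤ k →
                     (H : Hypergraph) (u : IsUniform k H) →
                     N * τ H (uniform⇒transversal k H u) ≤ B * (size H + order H)
admissible⇒τ-bound {N} {B} {ds} {k} adm j≤k H u
  with T , tr , bound ← greedy-transversal adm (edges H)
                          (All.map (λ eq → ≤-trans j≤k (≤-reflexive (sym eq))) u)
  with S , (_ , min) , eq ← τ-spec H (uniform⇒transversal k H u)
  = begin
    N * τ H (uniform⇒transversal k H u)  ≡⟨ cong (N *_) eq ⟨
    N * ∣ S ∣                            ≤⟨ *-monoʳ-≤ N (min T tr) ⟩
    N * ∣ T ∣                            ≤⟨ bound ⟩
    potential B ds (edges H)             ≤⟨ +-monoˡ-≤ (B * size H) (∑-const-≤ λ v →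
                                              ≤-trans (weight-≤sum ds (deg (edges H) v)) (bounded adm)) ⟩
    order H * B + B * size H             ≡⟨ collect B (order H) (size H) ⟩
    B * (size H + order H)               ∎
  where
  open ≤-Reasoning
  collect : ∀ b n m → n * b + b * m ≡ b * (m + n)
  collect = solve-∀

admissible⇒c≤ : ∀ {k j} .{{_ : NonZero j}} .{{_ : NonZero k}} .{{_ : NonZero N}} →
                Admissible j N B ds → j ≤ k → c k ≤ᴿ fromℚ (+ B / N)
admissible⇒c≤ {N} {B} {k = k} adm j≤k =
  sup-least (tuzaRatio k) (fromℚ (+ B / N)) λ H p<r → ℚ.<-≤-trans p<r (ratio≤ H)
  where
  ratio≤ : ∀ H → tuzaRatio k H ℚ.≤ + B / N
  ratio≤ H = /-mono-cross (τ hypergraph _) (size hypergraph + order hypergraph) B N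
    (≤-trans (≤-reflexive (*-comm _ N)) (admissible⇒τ-bound adm j≤k hypergraph uniform))
    where open UniformHypergraph H

theorem1 : (c 7 ≤ᴿ fromℚ (+ 1916 / 10000))
    × (c 8 ≤ᴿ fromℚ (+ 1772 / 10000))
    × (∀ (k : ℕ) .{{_ : NonZero k}} → 9 ≤ k → k ≤ 17 → c k ≤ᴿ fromℚ (+ 1667 / 10000))
-- The values a(1), a(2), … solve Gain with equality, rounded up to multiples of
-- 50 or 100, until the degree is so large that a(d) + B d ≥ N.
theorem1 =
    admissible⇒c≤ (from-yes (admissible? 7 10000 1916 (1200 ∷ 400 ∷ 200 ∷ 100 ∷ []))) ≤-refl
  , admissible⇒c≤ (from-yes (admissible? 8 10000 1772 (1050 ∷ 400 ∷ 150 ∷ 50 ∷ []))) ≤-refl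
  , λ k 9≤k _ → admissible⇒c≤ (from-yes (admissible? 9 10000 1667 (950 ∷ 350 ∷ 150 ∷ 100 ∷ 50 ∷ []))) 9≤k
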